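{- Assume the Univalence Axiom. Given $x,y:M$, the following equivalence of types holds: $$(x=_M y)\;\simeq\;\prod_{z:M}\bigl(z\in x\;\simeq\; z\in y\bigr).$$
   Context: The setting is Martin-Löf (homotopy/univalent) type theory; $A:\mathrm{Set}$ means "$A$ is a type" (not necessarily a 0-type), and $A\simeq B$ is the type of equivalences as in the Homotopy Type Theory book. The Univalence Axiom is assumed; in particular function extensionality holds for all types. $U:\mathrm{Set}$ is a univalent universe with decoding function $T:U\to\mathrm{Set}$; univalent means that for $a,b:U$ the canonical map $\mathrm{Id}_U\,a\,b\to (T\,a\simeq T\,b)$ is an equivalence. $U$ is assumed closed under $+$, $\Sigma$-, $\Pi$- and identity types. $M := W_{a:U}\,T\,a$ is the W-type with canonical elements $\sup\,a\,f$, where $a:U$ and $f:T\,a\to M$. The relation $=_M\,:M\to M\to\mathrm{Set}$ is defined by recursion: $$(\sup\,a\,f)=_M(\sup\,b\,g)\;:=\;\sum_{\alpha:T a\simeq T b}\ \prod_{x:T a}\ (f\,x)=_M\bigl(g\,(\alpha\,x)\bigr).$$ The relation $\in\,:M\to M\to\mathrm{Set}$ is defined by $$x\in(\sup\,b\,g)\;:=\;\sum_{i:T b}\ x=_M(g\,i).$$ -}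

{-# OPTIONS --without-K #-}

module Defs where

open import Level using (Level; _⊔_; suc)
open import Data.Container.Core using (_▷_)
open import Data.Product.Base using (Σ; _,_)
open import Data.Sum.Base using (_⊎_)
open import Data.W using (W; sup)
open import Function.Base using (id)
open import Function.Properties.Inverse.HalfAdjointEquivalence using (_≃_)
open import Relation.Binary.PropositionalEquality.Core using (_≡_; refl; cong)

private
  variable
    a b ℓ : Level

-- The fields are those of the half adjoint equivalence A ≃ B, with the
-- forward map made a parameter.
record IsEquiv {A : Set a} {B : Set b} (f : A → B) : Set (a ⊔ b) where
  field
    from             : B → A
    left-inverse-of  : ∀ x → from (f x) ≡ x
    right-inverse-of : ∀ y → f (from y) ≡ y
    left-right       : ∀ x → cong f (left-inverse-of x) ≡ right-inverse-of (f x)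

≃-refl : {A : Set a} → A ≃ A
≃-refl = record
  { to               = id
  ; from             = id
  ; left-inverse-of  = λ _ → refl
  ; right-inverse-of = λ _ → refl
  ; left-right       = λ _ → refl
  }

≡⇒≃ : {U : Set a} (T : U → Set b) {u v : U} → u ≡ v → T u ≃ T v
≡⇒≃ T refl = ≃-refl

Univalent : {U : Set a} (T : U → Set b) → Set (a ⊔ b)
Univalent T = ∀ u v → IsEquiv (≡⇒≃ T {u} {v})

UnivalenceAxiom : ∀ ℓ → Set (suc ℓ)
UnivalenceAxiom ℓ = Univalent {U = Set ℓ} (λ A → A)

-- Decoding of a code is specified up to equivalence: judgmental
-- equality is not available as a hypothesis, and under the univalence
-- axiom ≃ and ≡ between types of Set ℓ amount to the same.
record Closed {U : Set ℓ} (T : U → Set ℓ) : Set ℓ where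
  field
    _⊕_   : U → U → U
    sigma : (u : U) → (T u → U) → U
    pi    : (u : U) → (T u → U) → U
    ident : (u : U) → T u → T u → U

    T-⊕     : ∀ u v → T (u ⊕ v) ≃ (T u ⊎ T v)
    T-sigma : ∀ u v → T (sigma u v) ≃ Σ (T u) (λ i → T (v i))
    T-pi    : ∀ u v → T (pi u v) ≃ ((i : T u) → T (v i))
    T-ident : ∀ u i j → T (ident u i j) ≃ (i ≡ j)

M : {U : Set ℓ} (T : U → Set ℓ) → Set ℓ
M {U = U} T = W (U ▷ T)

module _ {U : Set ℓ} {T : U → Set ℓ} where

  infix 4 _=M_ _∈_

  _=M_ : M T → M T → Set ℓ
  sup (u , f) =M sup (v , g) =
    Σ (T u ≃ T v) λ α → (i : T u) → f i =M g (_≃_.to α i)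

  _∈_ : M T → M T → Set ℓ
  x ∈ sup (v , g) = Σ (T v) λ i → x =M g i

{-# OPTIONS --without-K #-}
module Submission where

-- Write x = sup u f and y = sup v g.  The argument has three steps.
--
-- First, =M is the identity type of M (=M↔≡).  By induction, x =M y is
-- equivalent to the type of pairs of an equivalence α : T u ≃ T v and
-- a homotopy f i ≡ g (α i); univalence of U replaces α by an identity
-- u ≡ v, and such pairs make up the identity type of the W-type.
-- Hence z ∈ sup v g is equivalent to the fibre of g over z.
--
-- Second, for arbitrary maps f : A → X and g : B → X, an equivalence
-- A ≃ B together with a homotopy making the triangle over X commute is
-- the same thing as a family of equivalences between the fibres of f
-- and of g (Over↔fibrewise).  At the level of functions this is the
-- Yoneda lemma: a family of maps from the fibres of f to the fibres of
-- g is determined by its values at the points (i , refl).  Since being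
-- an equivalence is a proposition (IsEquiv-isProp), it only remains to
-- see that the fibrewise maps are equivalences exactly when the map
-- A → B is one, and this holds because A is the total space of the
-- fibres of f.
--
-- Third, x =M y is therefore equivalent to the type of families of
-- equivalences between the fibres of f and g, and so to the type of
-- families of equivalences between z ∈ x and z ∈ y.
--
-- Function extensionality is needed throughout; it is derived from the
-- univalence axiom at the single level involved.

open import Axiom.Extensionality.Propositional using (Extensionality)
open import Data.Product.Base using (Σ; _,_; proj₁; proj₂)
open import Data.Product.Function.Dependent.Propositional using (Σ-↔)
open import Data.W using (sup)
open import Function.Base using (id; _∘_)
open import Function.Bundles using (_↔_; mk↔ₛ′; Inverse)
open import Function.Properties.Inverse using (↔-refl; ↔-sym; ↔-trans)
open import Function.Properties.Inverse.HalfAdjointEquivalence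
  using (_≃_; ↔⇒≃; ≃⇒↔)
open import Function.Related.Propositional using (≡⇒)
open import Level using (Level)
open import Relation.Binary.PropositionalEquality
  using (_≡_; refl; sym; trans; cong; cong₂; cong-app; subst;
         trans-symˡ; trans-symʳ)
open import Defs

private
  variable
    a b ℓ : Level

-- Preliminaries on equivalences and identity types

-- Homotopy propositions: any two elements are equal.
IsProp : Set a → Set a
IsProp A = (p q : A) → p ≡ q

-- The fibre of f over z.  The identity is oriented as in the
-- definition of ∈.
Fibre : {A : Set a} {X : Set b} → (A → X) → X → Set _
Fibre {A = A} f z = Σ A λ i → z ≡ f i

Fibre-total : {A : Set a} {X : Set b} (f : A → X) → A ↔ Σ X (Fibre f)
Fibre-total f = mk↔ₛ′
  (λ i → f i , i , refl)
  (λ { (_ , i , _) → i })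
  (λ { (_ , i , refl) → refl })
  (λ _ → refl)

trans-↔ : {A : Set a} {x y : A} (z : A) → x ≡ y → (z ≡ x) ↔ (z ≡ y)
trans-↔ z p = mk↔ₛ′
  (λ q → trans q p)
  (λ q → trans q (sym p))
  (λ { refl → trans-symˡ p })
  (λ { refl → trans-symʳ p })

isEquiv : {A : Set a} {B : Set b} (α : A ≃ B) → IsEquiv (_≃_.to α)
isEquiv α = record
  { from             = from
  ; left-inverse-of  = left-inverse-of
  ; right-inverse-of = right-inverse-of
  ; left-right       = left-right
  }
  where open _≃_ α

equiv : {A : Set a} {B : Set b} (k : A → B) → IsEquiv k → A ≃ B
equiv k e = record
  { to               = k
  ; from             = from
  ; left-inverse-of  = left-inverse-of
  ; right-inverse-of = right-inverse-of
  ; left-right       = left-right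
  }
  where open IsEquiv e

Univalent⇒↔ : {U : Set a} {T : U → Set b} → Univalent T →
              ∀ u v → (u ≡ v) ↔ (T u ≃ T v)
Univalent⇒↔ {T = T} univ u v = ≃⇒↔ (equiv (≡⇒≃ T) (univ u v))

module _ (ua : UnivalenceAxiom ℓ) where

  ≃⇒≡ : {A B : Set ℓ} → A ≃ B → A ≡ B
  ≃⇒≡ {A} {B} = IsEquiv.from (ua A B)

  -- Equivalence induction.
  ≃-elim : {B : Set ℓ} (P : ∀ A → A ≃ B → Set a) →
           P B ≃-refl → ∀ A (α : A ≃ B) → P A α
  ≃-elim {B = B} P base A α =
    subst (P A) (IsEquiv.right-inverse-of (ua A B) α) (go (≃⇒≡ α))
    where
    go : ∀ {A} (p : A ≡ B) → P A (≡⇒≃ (λ A → A) p)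
    go refl = base

-- Function extensionality

  -- An equivalence has at most one section, when being a section is
  -- stated as an identity of functions.  By equivalence induction it
  -- suffices to treat the identity, whose sections form a singleton.
  sections-isProp : {A : Set ℓ} (X : Set ℓ) (α : X ≃ A) →
                    IsProp (Σ (A → X) λ s → _≃_.to α ∘ s ≡ id)
  sections-isProp = ≃-elim
    (λ X α → IsProp (Σ (_ → X) λ s → _≃_.to α ∘ s ≡ id))
    λ { (_ , refl) (_ , refl) → refl }

  -- The type of functions g with a homotopy from f to g is contractible
  -- to f itself.  Such data are the choices of an element in each of the
  -- singletons Q x, and hence a retract of the sections of the
  -- projection Σ A Q → A, which is an equivalence.
  homotopies-contr : {A : Set ℓ} {B : A → Set ℓ} {f g : ∀ x → B x}
                     (h : ∀ x → f x ≡ g x) →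
                     _≡_ {A = Σ (∀ x → B x) λ g → ∀ x → f x ≡ g x}
                       (f , λ _ → refl) (g , h)
  homotopies-contr {A} {B} {f} {g} h =
    cong (distribute ∘ choice)
      (sections-isProp _ proj-≃ (section {f} λ _ → refl) (section {g} h))
    where
    Q : A → Set ℓ
    Q x = Σ (B x) λ y → f x ≡ y

    proj-≃ : Σ A Q ≃ A
    proj-≃ = record
      { to               = proj₁
      ; from             = λ x → x , f x , refl
      ; left-inverse-of  = λ { (_ , _ , refl) → refl }
      ; right-inverse-of = λ _ → refl
      ; left-right       = λ { (_ , _ , refl) → refl }
      }

    Section : Set ℓ
    Section = Σ (A → Σ A Q) λ s → proj₁ ∘ s ≡ id

    section : ∀ {g} → (∀ x → f x ≡ g x) → Section
    section {g} h = (λ x → x , g x , h x) , refl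

    -- A retraction of the evident map from ∀ x → Q x to Section.
    choice : Section → ∀ x → Q x
    choice (s , p) x = subst Q (cong-app p x) (proj₂ (s x))

    distribute : (∀ x → Q x) → Σ (∀ x → B x) λ g → ∀ x → f x ≡ g x
    distribute s = proj₁ ∘ s , proj₂ ∘ s

  -- The inverse of the contraction at the constant homotopy is composed
  -- in front so that funext-refl holds.
  funext : Extensionality ℓ ℓ
  funext h =
    cong proj₁ (trans (sym (homotopies-contr (λ _ → refl)))
                      (homotopies-contr h))

  funext-refl : {A : Set ℓ} {B : A → Set ℓ} (f : ∀ x → B x) →
                funext {f = f} (λ _ → refl) ≡ refl
  funext-refl f =
    cong (cong proj₁) (trans-symˡ (homotopies-contr {f = f} (λ _ → refl)))

  -- Homotopy induction.
  ~-elim : {A : Set ℓ} {B : A → Set ℓ} {f : ∀ x → B x}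
           (P : ∀ g → (∀ x → f x ≡ g x) → Set a) →
           P f (λ _ → refl) → ∀ {g} h → P g h
  ~-elim {f = f} P base h =
    subst (λ { (g , h) → P g h })
      (trans (sym (homotopies-contr {f = f} (λ _ → refl)))
             (homotopies-contr h))
      base

  cong-app-funext : {A : Set ℓ} {B : A → Set ℓ} {f g : ∀ x → B x}
                    (h : ∀ x → f x ≡ g x) → cong-app (funext h) ≡ h
  cong-app-funext {f = f} =
    ~-elim (λ _ h → cong-app (funext h) ≡ h) (cong cong-app (funext-refl f))

  Π-↔ : {A : Set ℓ} {B C : A → Set ℓ} →
        (∀ x → B x ↔ C x) → (∀ x → B x) ↔ (∀ x → C x)
  Π-↔ e = mk↔ₛ′
    (λ k x → Inverse.to (e x) (k x))
    (λ k x → Inverse.from (e x) (k x))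
    (λ k → funext λ x → Inverse.strictlyInverseˡ (e x) (k x))
    (λ k → funext λ x → Inverse.strictlyInverseʳ (e x) (k x))

-- Equality of equivalences

  -- The data making the identity an equivalence form two singletons: an
  -- inverse r with a homotopy η from r to the identity, and a homotopy ε
  -- with a homotopy from cong id ∘ η to ε.
  IsEquiv-id-contr : {A : Set ℓ} (e : IsEquiv (id {A = A})) →
                     isEquiv ≃-refl ≡ e
  IsEquiv-id-contr {A} e =
    subst (λ η → ∀ ε coh → isEquiv ≃-refl ≡ mk from η ε coh)
      (cong-app-funext left-inverse-of)
      (unit (funext left-inverse-of))
      right-inverse-of left-right
    where
    open IsEquiv e

    mk : (r : A → A) (η : ∀ x → r x ≡ x) (ε : ∀ x → r x ≡ x) →
         (∀ x → cong id (η x) ≡ ε x) → IsEquiv (id {A = A})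
    mk r η ε coh = record
      { from             = r
      ; left-inverse-of  = η
      ; right-inverse-of = ε
      ; left-right       = coh
      }

    -- η is replaced by cong-app q, so that r can be eliminated as well.
    unit : ∀ {r} (q : r ≡ id) ε coh →
           isEquiv ≃-refl ≡ mk r (cong-app q) ε coh
    unit refl ε =
      ~-elim (λ ε coh → isEquiv ≃-refl ≡ mk id (λ _ → refl) ε coh) refl

  IsEquiv-isProp : {A B : Set ℓ} (α : A ≃ B) → IsProp (IsEquiv (_≃_.to α))
  IsEquiv-isProp = ≃-elim (λ _ α → IsProp (IsEquiv (_≃_.to α)))
    (λ p q → trans (sym (IsEquiv-id-contr p)) (IsEquiv-id-contr q)) _

  ≃-ext : {A B : Set ℓ} {α β : A ≃ B} →
          (∀ x → _≃_.to α x ≡ _≃_.to β x) → α ≡ β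
  ≃-ext {α = α} {β} h = go (funext h) (isEquiv α) (isEquiv β)
    where
    go : ∀ {k l} → k ≡ l → ∀ d e → equiv k d ≡ equiv l e
    go {k} refl d e = cong (equiv k) (IsEquiv-isProp (equiv k d) d e)

-- Equivalences over a base

  module _ {A B X : Set ℓ} (f : A → X) (g : B → X) where

    -- Equivalences A ≃ B over X.
    Over : Set ℓ
    Over = Σ (A ≃ B) λ α → ∀ i → f i ≡ g (_≃_.to α i)

    -- Maps A → B over X.
    MapOver : Set ℓ
    MapOver = Σ (A → B) λ k → ∀ i → f i ≡ g (k i)

    underlying : Over → MapOver
    underlying (α , p) = _≃_.to α , p

    -- Being an equivalence is a proposition, so equality in Over is
    -- equality of the underlying maps over X.
    Over-ext : (o o′ : Over) → underlying o ≡ underlying o′ → o ≡ o′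
    Over-ext (α , _) (β , _) eq = go eq (isEquiv α) (isEquiv β)
      where
      go : {m n : MapOver} → m ≡ n → ∀ d e →
           _≡_ {A = Over} (equiv (proj₁ m) d , proj₂ m)
                          (equiv (proj₁ n) e , proj₂ n)
      go {k , p} refl d e =
        cong (λ e → equiv k e , p) (IsEquiv-isProp (equiv k d) d e)

    fibrewise : Over → ∀ z → Fibre f z ≃ Fibre g z
    fibrewise (α , p) z =
      ↔⇒≃ (Σ-↔ (≃⇒↔ α) (λ {i} → trans-↔ z (p i)))

    -- The equivalence of total spaces induced by a fibrewise equivalence.
    total : (∀ z → Fibre f z ≃ Fibre g z) → Over
    total h =
      ↔⇒≃ (↔-trans (Fibre-total f)
            (↔-trans (Σ-↔ ↔-refl (λ {z} → ≃⇒↔ (h z)))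
              (↔-sym (Fibre-total g)))) ,
      λ i → proj₂ (_≃_.to (h (f i)) (i , refl))

    fibrewise-total : ∀ h z (s : Fibre f z) →
                      _≃_.to (fibrewise (total h) z) s ≡ _≃_.to (h z) s
    fibrewise-total h _ (_ , refl) = refl

    Over↔fibrewise : Over ↔ (∀ z → Fibre f z ≃ Fibre g z)
    Over↔fibrewise = mk↔ₛ′ fibrewise total
      (λ h → funext λ z → ≃-ext (fibrewise-total h z))
      -- The map underlying total (fibrewise o) computes to that of o; the
      -- proofs of equivalence differ.
      (λ o → Over-ext (total (fibrewise o)) o refl)

-- Equality and membership in M

  module _ {U : Set ℓ} {T : U → Set ℓ} (univ : Univalent T) where

    -- The identity type of a W-type.  The transport of positions
    -- along p is expressed through the equivalence ≡⇒≃ T p.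
    sup-≡-↔ : ∀ {u v} {f : T u → M T} {g : T v → M T} →
              (Σ (u ≡ v) λ p → ∀ i → f i ≡ g (_≃_.to (≡⇒≃ T p) i)) ↔
              _≡_ {A = M T} (sup (u , f)) (sup (v , g))
    sup-≡-↔ {u} {f = f} = mk↔ₛ′ to from
      (λ { refl → cong (cong sup′) (funext-refl f) })
      (λ { (refl , h) →
             ~-elim (λ _ h → from (to (refl , h)) ≡ (refl , h))
               (cong (from ∘ cong sup′) (funext-refl f)) h })
      where
      sup′ : ∀ {v} → (T v → M T) → M T
      sup′ {v} g = sup (v , g)

      to : ∀ {v} {g : T v → M T} →
           (Σ (u ≡ v) λ p → ∀ i → f i ≡ g (_≃_.to (≡⇒≃ T p) i)) →
           sup′ f ≡ sup′ g
      to (refl , h) = cong sup′ (funext h)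

      from : ∀ {v} {g : T v → M T} → sup′ f ≡ sup′ g →
             Σ (u ≡ v) λ p → ∀ i → f i ≡ g (_≃_.to (≡⇒≃ T p) i)
      from refl = refl , λ _ → refl

    Over↔≡ : ∀ {u v} {f : T u → M T} {g : T v → M T} →
             Over f g ↔ _≡_ {A = M T} (sup (u , f)) (sup (v , g))
    Over↔≡ {u} {v} =
      ↔-trans (↔-sym (Σ-↔ (Univalent⇒↔ univ u v) ↔-refl)) sup-≡-↔

    =M↔≡ : (x y : M T) → (x =M y) ↔ (x ≡ y)
    =M↔≡ (sup (u , f)) (sup (v , g)) =
      ↔-trans (Σ-↔ ↔-refl (λ {α} → Π-↔ λ i → =M↔≡ (f i) (g (_≃_.to α i))))
        Over↔≡

    ∈↔Fibre : ∀ z v (g : T v → M T) → (z ∈ sup (v , g)) ↔ Fibre g z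
    ∈↔Fibre z v g = Σ-↔ ↔-refl (λ {i} → =M↔≡ z (g i))

    extensionality : (x y : M T) →
                     (x =M y) ↔ ((z : M T) → (z ∈ x) ≃ (z ∈ y))
    extensionality x@(sup (u , f)) y@(sup (v , g)) =
      ↔-trans (=M↔≡ x y)
        (↔-trans (↔-sym Over↔≡)
          (↔-trans (Over↔fibrewise f g)
            (Π-↔ λ z → ≡⇒ (cong₂ _≃_ (sym (∈≡Fibre z u f))
                                     (sym (∈≡Fibre z v g))))))
      where
      -- Univalence makes this an identity, so that no separate congruence
      -- of ≃ is needed.
      ∈≡Fibre : ∀ z v (g : T v → M T) → (z ∈ sup (v , g)) ≡ Fibre g z
      ∈≡Fibre z v g = ≃⇒≡ (↔⇒≃ (∈↔Fibre z v g))

theorem3 : ∀ {ℓ} → UnivalenceAxiom ℓ →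
    (U : Set ℓ) (T : U → Set ℓ) → Univalent T → Closed T →
    (x y : M T) →
    (x =M y) ≃ ((z : M T) → (z ∈ x) ≃ (z ∈ y))
theorem3 ua U T univ _ x y = ↔⇒≃ (extensionality ua univ x y)
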